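{- Let $G$ be a connected graph with minimum degree $\delta$ and maximum degree $\Delta$. Then $\mathrm{vp}^-(G) \geq \delta$ and $\mathrm{vp}(G) \geq \Delta$.
   Context: All graphs are finite, undirected and simple. A $u,v$-geodesic is a shortest $u,v$-path. For a vertex $x$ of $G$, a set $S \subseteq V(G)$ is an $x$-position set if for every $y \in S$ no vertex of $S \setminus \{y\}$ lies on any $x,y$-geodesic in $G$. The $x$-position number $p_x(G)$ is the maximum cardinality of an $x$-position set of $G$. Define $\mathrm{vp}(G) = \max_{x \in V(G)} p_x(G)$ and $\mathrm{vp}^-(G) = \min_{x \in V(G)} p_x(G)$. -}

module Defs where

open import Data.Fin.Base using (Fin; zero)
open import Data.Fin.Properties as Fin using (any?; all?; injective⇒≤)
open import Data.Fin.Subset using (Subset; ∣_∣; _∈_)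
open import Data.Fin.Subset.Properties using (_∈?_; anySubset?)
open import Data.List.Base using (List; filter; upTo)
import Data.List.Base as List
open import Data.List.Extrema.Nat using (min; max)
open import Data.Nat.Base using (ℕ; zero; suc; _≤_; _<_)
open import Data.Nat.Properties as ℕ using (≮⇒≥; <⇒≱; anyUpTo?; allUpTo?)
open import Data.Product.Base using (Σ; ∃; ∃-syntax; _×_; _,_; proj₁; proj₂)
open import Data.Vec.Base using (Vec; []; _∷_; head; last; tabulate)
import Data.Vec.Membership.Propositional as Vec
import Data.Vec.Membership.DecPropositional as DecVec
open import Data.Vec.Relation.Unary.AllPairs using (allPairs?)
open import Data.Vec.Relation.Unary.Linked using (Linked; linked?)
open import Data.Vec.Relation.Unary.Unique.Propositional using (Unique)
open import Data.Vec.Relation.Unary.Unique.Propositional.Properties using (lookup-injective)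
open import Relation.Binary.Core using (Rel)
open import Relation.Binary.Definitions using (Decidable; Symmetric; Irreflexive)
open import Relation.Binary.PropositionalEquality using (_≡_; _≢_; refl)
open import Relation.Nullary.Decidable using (Dec; does; map′; ¬?; _×-dec_; _→-dec_)
open import Relation.Nullary.Negation using (¬_)
import Relation.Unary as Unary
open import Level using (0ℓ)

record Graph (n : ℕ) : Set₁ where
  infix 4 _~_ _~?_
  field
    _~_    : Rel (Fin n) 0ℓ
    _~?_   : Decidable _~_
    sym    : Symmetric _~_
    irrefl : Irreflexive _≡_ _~_

module _ {n : ℕ} (G : Graph n) where
  open Graph G

  neighbourhood : Fin n → Subset n
  neighbourhood x = tabulate (λ y → does (x ~? y))

  degree : Fin n → ℕ
  degree x = ∣ neighbourhood x ∣

  -- A path of length k is the sequence of its k + 1 distinct vertices.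
  IsPath : (u v : Fin n) {k : ℕ} → Vec (Fin n) (suc k) → Set
  IsPath u v w = head w ≡ u × last w ≡ v × Linked _~_ w × Unique w

  Connected : Set
  Connected = ∀ u v → ∃[ k ] Σ (Vec (Fin n) (suc k)) (IsPath u v)

  IsGeodesic : (u v : Fin n) {k : ℕ} → Vec (Fin n) (suc k) → Set
  IsGeodesic u v {k} w =
    IsPath u v w × (∀ {j} (w′ : Vec (Fin n) (suc j)) → IsPath u v w′ → k ≤ j)

  OnGeodesic : (u v z : Fin n) → Set
  OnGeodesic u v z =
    ∃[ k ] Σ (Vec (Fin n) (suc k)) λ w → IsGeodesic u v w × z Vec.∈ w

  IsPositionSet : Fin n → Subset n → Set
  IsPositionSet x S =
    ∀ y → y ∈ S → ∀ z → z ∈ S → z ≢ y → ¬ OnGeodesic x y z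

-- Decidability of being an x-position set, by exhaustive search; needed to
-- define p_x(G) as a function.

anyVec? : ∀ {n m} {P : Vec (Fin n) m → Set} → Unary.Decidable P → Dec (∃ P)
anyVec? {m = zero}  P? = map′ (λ p → [] , p) (λ { ([] , p) → p }) (P? [])
anyVec? {m = suc m} P? =
  map′ (λ { (x , xs , p) → x ∷ xs , p })
       (λ { (x ∷ xs , p) → x , xs , p })
       (any? λ x → anyVec? λ xs → P? (x ∷ xs))

module _ {n : ℕ} (G : Graph n) where
  open Graph G

  isPath? : ∀ u v {k} (w : Vec (Fin n) (suc k)) → Dec (IsPath G u v w)
  isPath? u v w =
    (head w Fin.≟ u) ×-dec (last w Fin.≟ v) ×-dec
    linked? _~?_ w ×-dec allPairs? (λ x y → ¬? (x Fin.≟ y)) w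

  path-length< : ∀ {u v k} {w : Vec (Fin n) (suc k)} → IsPath G u v w → k < n
  path-length< (_ , _ , _ , uniq) =
    injective⇒≤ (λ {i} {j} → lookup-injective uniq i j)

  isGeodesic? : ∀ u v {k} (w : Vec (Fin n) (suc k)) → Dec (IsGeodesic G u v w)
  isGeodesic? u v {k} w = isPath? u v w ×-dec
    map′ (λ none {_} w′ p → ≮⇒≥ (λ j<k → none j<k (w′ , p)))
         (λ shortest {_} j<k (w′ , p) → <⇒≱ j<k (shortest w′ p))
         (allUpTo? (λ j → ¬? (anyVec? {m = suc j} (isPath? u v))) k)

  onGeodesic? : ∀ u v z → Dec (OnGeodesic G u v z)
  onGeodesic? u v z =
    map′ (λ (k , _ , q) → k , q)
         (λ (k , w , g , z∈w) → k , path-length< (proj₁ g) , w , g , z∈w)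
         (anyUpTo? (λ k → anyVec? {m = suc k} λ w →
            isGeodesic? u v w ×-dec DecVec._∈?_ Fin._≟_ z w) n)

  isPositionSet? : ∀ x S → Dec (IsPositionSet G x S)
  isPositionSet? x S =
    all? λ y → (y ∈? S) →-dec
    all? λ z → (z ∈? S) →-dec (¬? (z Fin.≟ y) →-dec ¬? (onGeodesic? x y z))

  -- The cardinalities of x-position sets; all are at most n.
  positionCardinalities : Fin n → List ℕ
  positionCardinalities x =
    filter (λ k → anySubset? λ S → isPositionSet? x S ×-dec (∣ S ∣ ℕ.≟ k))
           (upTo (suc n))

  -- The default 0 is the cardinality of the empty set, always an x-position set.
  positionNumber : Fin n → ℕ
  positionNumber x = max 0 (positionCardinalities x)

-- min and max take a default, which counts as one more element of the list;
-- the value at vertex zero serves, so the vertex set has to be nonempty.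
minVertices maxVertices : ∀ {n} → (Fin (suc n) → ℕ) → ℕ
minVertices f = min (f zero) (List.tabulate f)
maxVertices f = max (f zero) (List.tabulate f)

module _ {n : ℕ} (G : Graph (suc n)) where

  δ Δ vp vp⁻ : ℕ
  δ   = minVertices (degree G)
  Δ   = maxVertices (degree G)
  vp  = maxVertices (positionNumber G)
  vp⁻ = minVertices (positionNumber G)

{-# OPTIONS --safe #-}
-- A vertex z on an x,y-geodesic with x ~ y is x or y, since the geodesic is
-- just the edge xy. Hence the neighbourhood of x is an x-position set, and
-- p_x(G) ≥ deg x for every vertex x.
module Submission where

open import Defs
open import Data.Fin.Base using (Fin; zero)
open import Data.Fin.Subset using (_∈_; ∣_∣)
open import Data.Fin.Subset.Properties using (∣p∣≤n; anySubset?)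
open import Data.List.Extrema.Nat
  using (xs≤max; min[xs]≤min[ys]⁺; max[xs]≤max[ys]⁺)
open import Data.List.Membership.Propositional.Properties
  using (∈-filter⁺; ∈-upTo⁺)
import Data.List.Base as List
import Data.List.Relation.Unary.All as All
import Data.List.Relation.Unary.All.Properties as All
import Data.List.Relation.Unary.Any.Properties as Any
open import Data.Nat.Base using (ℕ; suc; _≤_; _≥_; s≤s)
open import Data.Nat.Properties using (_≟_)
open import Data.Product.Base using (_×_; _,_)
open import Data.Sum.Base using (_⊎_; inj₁; inj₂; [_,_])
open import Data.Vec.Base using ([]; _∷_)
open import Data.Vec.Properties using (lookup∘tabulate; []=⇒lookup)
open import Data.Vec.Relation.Unary.All using ([]; _∷_)
open import Data.Vec.Relation.Unary.AllPairs using ([]; _∷_)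
open import Data.Vec.Relation.Unary.Any using (here; there)
open import Data.Vec.Relation.Unary.Linked using ([-]; _∷_)
open import Relation.Binary.PropositionalEquality using (_≡_; refl; sym; trans)
open import Relation.Nullary.Decidable using (yes; no; _×-dec_)
open import Relation.Nullary.Negation using (contradiction)

-- Both inequalities come from one pointwise bound, `degree≤positionNumber`: the neighbours of x
-- form an x-position set of size deg x, because a geodesic between adjacent vertices has no inner
-- vertex (`onGeodesic-edge`). Minimum and maximum over the vertices are monotone, so the bound
-- passes to each.

module _ {n : ℕ} (f g : Fin (suc n) → ℕ) (f≤g : ∀ i → f i ≤ g i) where

  minVertices-mono : minVertices f ≤ minVertices g
  minVertices-mono = min[xs]≤min[ys]⁺ (f zero) (List.tabulate f)
    -- The default values at `zero` are compared with each other; every other entry `g i` is matched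
    -- with `f i`.
    (inj₁ (f≤g zero))
    (All.tabulate⁺ {f = g} λ i → inj₂ (Any.tabulate⁺ {f = f} i (f≤g i)))

  maxVertices-mono : maxVertices f ≤ maxVertices g
  maxVertices-mono = max[xs]≤max[ys]⁺ (g zero) (List.tabulate g)
    (inj₁ (f≤g zero))
    (All.tabulate⁺ {f = f} λ i → inj₂ (Any.tabulate⁺ {f = g} i (f≤g i)))

module _ {n : ℕ} (G : Graph n) where
  open Graph G using (_~_; _~?_; irrefl)

  ∈-neighbourhood⁻ : ∀ {x y} → y ∈ neighbourhood G x → x ~ y
  ∈-neighbourhood⁻ {x} {y} y∈N
    -- Membership becomes `does (x ~? y) ≡ true`; deciding `x ~? y` in the same `with` makes the
    -- negative case absurd.
    with x ~? y | trans (sym (lookup∘tabulate _ y)) ([]=⇒lookup y∈N)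
  ... | yes x~y | _  = x~y
  ... | no _    | ()

  edge-isPath : ∀ {x y} → x ~ y → IsPath G x y (x ∷ y ∷ [])
  edge-isPath x~y =
    refl , refl , x~y ∷ [-] , ((λ x≡y → irrefl x≡y x~y) ∷ []) ∷ [] ∷ []

  onGeodesic-edge : ∀ {x y z} → x ~ y → OnGeodesic G x y z → z ≡ x ⊎ z ≡ y
  onGeodesic-edge x~y (k , w , (path , shortest) , z∈w)
    -- The edge is a competing path of length 1, so `k ≤ 1`.
    with shortest _ (edge-isPath x~y)
  -- Length 0 need not be refuted: the only vertex is x, which already satisfies the claim.
  onGeodesic-edge x~y (0 , _ ∷ [] , ((refl , _) , _) , here z≡x) | _ = inj₁ z≡x
  onGeodesic-edge x~y (1 , _ ∷ _ ∷ [] , ((refl , refl , _) , _) , z∈w) | _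
    with z∈w
  ... | here z≡x         = inj₁ z≡x
  ... | there (here z≡y) = inj₂ z≡y
  onGeodesic-edge x~y (suc (suc _) , _) | s≤s ()

  neighbourhood-isPositionSet : ∀ x → IsPositionSet G x (neighbourhood G x)
  neighbourhood-isPositionSet x y y∈N z z∈N z≢y onGeo =
    -- x is not its own neighbour, and z differs from y by assumption, so neither end can be z.
    [ (λ z≡x → irrefl (sym z≡x) (∈-neighbourhood⁻ z∈N)) , z≢y ]
      (onGeodesic-edge (∈-neighbourhood⁻ y∈N) onGeo)

  -- `S` itself witnesses that its cardinality survives the filter, and the maximum bounds every
  -- surviving entry.
  ∣positionSet∣≤positionNumber :
    ∀ {x S} → IsPositionSet G x S → ∣ S ∣ ≤ positionNumber G x
  ∣positionSet∣≤positionNumber {x} {S} S-pos =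
    All.lookup (xs≤max 0 (positionCardinalities G x))
      (∈-filter⁺
        (λ k → anySubset? λ T → isPositionSet? G x T ×-dec (∣ T ∣ ≟ k))
        -- `upTo (suc n)` ends at n, the largest possible size of a subset.
        (∈-upTo⁺ (s≤s (∣p∣≤n S))) (S , S-pos , refl))

  degree≤positionNumber : ∀ x → degree G x ≤ positionNumber G x
  degree≤positionNumber x =
    ∣positionSet∣≤positionNumber (neighbourhood-isPositionSet x)

lemma2p5 : ∀ {n : ℕ} (G : Graph (suc n)) → Connected G → (vp⁻ G ≥ δ G) × (vp G ≥ Δ G)
lemma2p5 G _ =
  minVertices-mono (degree G) (positionNumber G) (degree≤positionNumber G) ,
  maxVertices-mono (degree G) (positionNumber G) (degree≤positionNumber G)
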